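{- Let $\mathrm{a}_{n,k}^{\mathrm{dasc}}(213,312)$ (respectively $\mathrm{a}_{n,k}^{\mathrm{ddes}}(213,312)$) denote the number of permutations of $\{1,\dots,n\}$ that avoid both $213$ and $312$ and have exactly $k$ double ascents (respectively $k$ double descents). Then for all integers $n\ge 1$ and $k\ge 0$, $$\mathrm{a}_{n,k}^{\mathrm{dasc}}(213,312)=\mathrm{a}_{n,k}^{\mathrm{ddes}}(213,312)=\begin{cases} n, & k=0;\\ \binom{n-1}{k+1}, & k\ge 1.\end{cases}$$
   Context: $\mathcal{S}_n$ is the set of permutations $\pi=\pi_1\cdots\pi_n$ of $\{1,\dots,n\}$. For $\rho\in\mathcal{S}_m$, $\pi\in\mathcal{S}_n$ contains $\rho$ if there are indices $1\le i_1<\cdots<i_m\le n$ such that $\pi_{i_a}<\pi_{i_b}$ if and only if $\rho_a<\rho_b$; otherwise $\pi$ avoids $\rho$. The number of double ascents is $\mathrm{dasc}(\pi)=|\{i:\pi_i<\pi_{i+1}<\pi_{i+2}\}|$ and the number of double descents is $\mathrm{ddes}(\pi)=|\{i:\pi_i>\pi_{i+1}>\pi_{i+2}\}|$, where $1\le i\le n-2$. Binomial coefficients $\binom{m}{j}$ with $j>m\ge 0$ are $0$. -}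

module Defs where

open import Data.Fin.Base using (Fin; zero; suc; inject₁; _<_; _>_)
open import Data.Fin.Patterns using (0F; 1F; 2F)
open import Data.Fin.Permutation using (Permutation′; permutation; _⟨$⟩ʳ_)
open import Data.Fin.Properties using (_<?_)
open import Data.List.Base using (allFin; filter; length)
open import Data.Nat.Base using (ℕ; zero; suc; _+_; _∸_)
open import Data.Nat.Combinatorics using (_C_)
open import Data.Product.Base using (Σ-syntax; _×_; proj₁)
open import Function.Base using (_∘_)
open import Function.Bundles using (Inverse; _⇔_)
open import Level using (0ℓ)
open import Relation.Binary.Bundles using (Setoid)
import Relation.Binary.Construct.On as On
open import Relation.Binary.PropositionalEquality using (_≡_; refl; setoid; _→-setoid_)
open import Relation.Nullary.Decidable using (_×-dec_)
open import Relation.Nullary.Negation using (¬_)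
open import Relation.Unary using (Pred; Decidable)

-- Positions and values are 0-based: πᵢ₊₁ = v + 1 corresponds to
-- toℕ (π ⟨$⟩ʳ i) ≡ v.

Contains : ∀ {m n} → Permutation′ n → Permutation′ m → Set
Contains {m} {n} π ρ =
  Σ[ ι ∈ (Fin m → Fin n) ]
    (∀ {a b : Fin m} → a < b → ι a < ι b)
  × (∀ (a b : Fin m) → (π ⟨$⟩ʳ ι a < π ⟨$⟩ʳ ι b) ⇔ (ρ ⟨$⟩ʳ a < ρ ⟨$⟩ʳ b))

Avoids : ∀ {m n} → Permutation′ n → Permutation′ m → Set
Avoids π ρ = ¬ Contains π ρ

p213 : Permutation′ 3
p213 = permutation to to invol invol
  where
  to : Fin 3 → Fin 3
  to 0F = 1F
  to 1F = 0F
  to 2F = 2F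

  invol : ∀ i → to (to i) ≡ i
  invol 0F = refl
  invol 1F = refl
  invol 2F = refl

p312 : Permutation′ 3
p312 = permutation to from to∘from from∘to
  where
  to : Fin 3 → Fin 3
  to 0F = 2F
  to 1F = 0F
  to 2F = 1F

  from : Fin 3 → Fin 3
  from 0F = 1F
  from 1F = 2F
  from 2F = 0F

  to∘from : ∀ i → to (from i) ≡ i
  to∘from 0F = refl
  to∘from 1F = refl
  to∘from 2F = refl

  from∘to : ∀ i → from (to i) ≡ i
  from∘to 0F = refl
  from∘to 1F = refl
  from∘to 2F = refl

-- For i : Fin m, the positions i, i + 1 and i + 2 of a word of length m + 2.

1st 2nd 3rd : ∀ {m} → Fin m → Fin (suc (suc m))
1st i = inject₁ (inject₁ i)
2nd i = inject₁ (suc i)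
3rd i = suc (suc i)

DoubleAscent DoubleDescent : ∀ {m} → Permutation′ (suc (suc m)) → Pred (Fin m) 0ℓ
DoubleAscent  π i = (π ⟨$⟩ʳ 1st i < π ⟨$⟩ʳ 2nd i) × (π ⟨$⟩ʳ 2nd i < π ⟨$⟩ʳ 3rd i)
DoubleDescent π i = (π ⟨$⟩ʳ 1st i > π ⟨$⟩ʳ 2nd i) × (π ⟨$⟩ʳ 2nd i > π ⟨$⟩ʳ 3rd i)

doubleAscent? : ∀ {m} (π : Permutation′ (suc (suc m))) → Decidable (DoubleAscent π)
doubleAscent? π i = (π ⟨$⟩ʳ 1st i <? π ⟨$⟩ʳ 2nd i) ×-dec (π ⟨$⟩ʳ 2nd i <? π ⟨$⟩ʳ 3rd i)

doubleDescent? : ∀ {m} (π : Permutation′ (suc (suc m))) → Decidable (DoubleDescent π)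
doubleDescent? π i = (π ⟨$⟩ʳ 2nd i <? π ⟨$⟩ʳ 1st i) ×-dec (π ⟨$⟩ʳ 3rd i <? π ⟨$⟩ʳ 2nd i)

dasc : ∀ {n} → Permutation′ n → ℕ
dasc {zero}        π = 0
dasc {suc zero}    π = 0
dasc {suc (suc m)} π = length (filter (doubleAscent? π) (allFin m))

ddes : ∀ {n} → Permutation′ n → ℕ
ddes {zero}        π = 0
ddes {suc zero}    π = 0
ddes {suc (suc m)} π = length (filter (doubleDescent? π) (allFin m))

-- Two elements are identified when they are pointwise equal as maps, so that
-- neither the inverse laws stored in a Permutation′ nor the proof of P
-- contributes to the count.

PermutationsWith : ∀ n → Pred (Permutation′ n) 0ℓ → Setoid 0ℓ 0ℓ
PermutationsWith n P =
  On.setoid {B = Σ[ π ∈ Permutation′ n ] P π} (Fin n →-setoid Fin n) (_⟨$⟩ʳ_ ∘ proj₁)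

infix 4 ∣_∣≡_

∣_∣≡_ : Setoid 0ℓ 0ℓ → ℕ → Set
∣ S ∣≡ N = Inverse S (setoid (Fin N))

Av⟨213,312⟩ : (∀ {n} → Permutation′ n → ℕ) → ℕ → ℕ → Setoid 0ℓ 0ℓ
Av⟨213,312⟩ stat n k =
  PermutationsWith n λ π → Avoids π p213 × Avoids π p312 × stat π ≡ k

formula : ℕ → ℕ → ℕ
formula n zero      = n
formula n k@(suc _) = (n ∸ 1) C (k + 1)

{-# OPTIONS --safe #-}

-- A permutation avoids 213 and 312 exactly when no entry has larger entries on
-- both sides, i.e. when the word increases up to its maximum and then decreases.
-- In such a word the minimum is the first or the last letter; deleting it again
-- and again encodes the avoiders of length n + 1 by the subsets of an n-set, the
-- chosen elements recording the minima found in front.  A word with a chosen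
-- elements has a ascents followed by n ∸ a descents, hence pred a double ascents
-- and pred (n ∸ a) double descents.
module Submission where

open import Algebra.Properties.CommutativeSemigroup using (x∙yz≈y∙xz)
open import Data.Bool.Base using (Bool; true; false; not; _∧_; if_then_else_)
open import Data.Bool.Properties using (∧-zeroʳ; ∧-identityʳ; not-involutive)
open import Data.Empty using (⊥)
open import Data.Fin.Base using (Fin; zero; suc; inject₁; fromℕ; punchIn; punchOut; toℕ; _<_)
open import Data.Fin.Patterns using (0F; 1F; 2F)
open import Data.Fin.Permutation as Perm
  using (Permutation; Permutation′; _⟨$⟩ʳ_; _⟨$⟩ˡ_; insert; remove; cast-id;
         inverseˡ; inverseʳ; insert-punchIn; insert-remove; punchIn-permute)
open import Data.Fin.Properties as Fin
  using (_≟_; _<?_; <-cmp; 1↔⊤; +↔⊎; ≤fromℕ; punchIn-mono-≤; punchIn-cancel-≤; punchIn-punchOut)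
open import Data.Fin.Subset using (Subset; ∣_∣; ∁) renaming (⊥ to ⊥ₛ)
open import Data.Fin.Subset.Properties using (∣⊥∣≡0)
open import Data.List.Base using (filter; length; tabulate)
open import Data.Nat.Base as ℕ using (ℕ; zero; suc; pred; _+_; _≥_; z≤n; s≤s)
open import Data.Nat.Combinatorics using (_C_; nC1≡n; nCk+nC[k+1]≡[n+1]C[k+1])
import Data.Nat.Properties as ℕ
open import Data.Product.Base using (Σ-syntax; ∃; _×_; _,_; proj₁; proj₂)
open import Data.Sum.Base using (_⊎_; inj₁; inj₂)
open import Data.Sum.Function.Propositional using (_⊎-↔_)
open import Data.Unit.Base using (⊤)
open import Data.Vec.Base using ([]; _∷_; lookup)
open import Data.Vec.Properties using (map-∘; map-cong; map-id)
open import Function.Base using (_∘_; id)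
open import Function.Bundles
  using (Inverse; Bijection; _↔_; Injection; Equivalence; mk↔ₛ′; mk⤖; mk⇔)
open import Function.Consequences.Propositional using (strictlySurjective⇒surjective)
import Function.Construct.Composition as Comp
open import Function.Construct.Identity using (↔-id)
import Function.Construct.Symmetry as Sym
open import Function.Properties.Bijection using (Bijection⇒Inverse; ⤖⇒↔)
open import Function.Properties.Inverse using (↔⇒↣; ↔-sym; ↔-trans)
open import Level using (0ℓ)
open import Relation.Binary.Bundles using (Setoid)
open import Relation.Binary.Definitions using (tri<; tri≈; tri>)
open import Relation.Binary.PropositionalEquality
open import Relation.Nullary.Decidable using (does; yes; no)
open import Relation.Nullary.Negation using (¬_; contradiction)
open import Relation.Unary using (Pred; Decidable)
open import Defs

private
  variable
    m n a k : ℕ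

-- Insertion into permutations and the order on `Fin`

⟨$⟩ʳ-injective : (π : Permutation m n) {i j : Fin m} → π ⟨$⟩ʳ i ≡ π ⟨$⟩ʳ j → i ≡ j
⟨$⟩ʳ-injective π = Injection.injective (↔⇒↣ π)

insert-at : ∀ i j (π : Permutation m n) → insert i j π ⟨$⟩ʳ i ≡ j
insert-at i j π with i ≟ i
... | yes _  = refl
... | no i≢i = contradiction refl i≢i

insert-cong : ∀ i j {π ρ : Permutation m n} → (∀ x → π ⟨$⟩ʳ x ≡ ρ ⟨$⟩ʳ x) →
              ∀ x → insert i j π ⟨$⟩ʳ x ≡ insert i j ρ ⟨$⟩ʳ x
insert-cong i j π≗ρ x with i ≟ x
... | yes _ = refl
... | no _  = cong (punchIn j) (π≗ρ _)

punchIn-mono-< : ∀ (i : Fin (suc n)) {j k} → j < k → punchIn i j < punchIn i k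
punchIn-mono-< i {j} {k} j<k =
  ℕ.≰⇒> λ k≤j → ℕ.<⇒≱ j<k (punchIn-cancel-≤ i k j k≤j)

punchIn-cancel-< : ∀ (i : Fin (suc n)) {j k} → punchIn i j < punchIn i k → j < k
punchIn-cancel-< i {j} {k} j<k =
  ℕ.≰⇒> λ k≤j → ℕ.<⇒≱ j<k (punchIn-mono-≤ i k j k≤j)

punchIn-fromℕ : (i : Fin n) → punchIn (fromℕ n) i ≡ inject₁ i
punchIn-fromℕ zero    = refl
punchIn-fromℕ (suc i) = cong suc (punchIn-fromℕ i)

≢0⇒0< : {i : Fin (suc n)} → i ≢ zero → zero {n} < i
≢0⇒0< {i = zero}  i≢0 = contradiction refl i≢0
≢0⇒0< {i = suc _} _   = s≤s z≤n

≢fromℕ⇒<fromℕ : {i : Fin (suc n)} → i ≢ fromℕ n → i < fromℕ n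
≢fromℕ⇒<fromℕ {i = i} i≢n = Fin.≤∧≢⇒< (≤fromℕ i) i≢n

-- Unimodality

-- Phrased as the absence of a valley, so that no maximum has to be located and the patterns 213 and
-- 312, which differ only in their outer entries, are excluded together.
Unimodal : Permutation′ n → Set
Unimodal π = ∀ {i j k} → i < j → j < k → π ⟨$⟩ʳ j < π ⟨$⟩ʳ i → ¬ π ⟨$⟩ʳ j < π ⟨$⟩ʳ k

fin3-monotone : (f : Fin 3 → Fin n) → f 0F < f 1F → f 1F < f 2F →
                ∀ {x y} → x < y → f x < f y
fin3-monotone f f₀<f₁ f₁<f₂ {0F} {1F} _ = f₀<f₁
fin3-monotone f f₀<f₁ f₁<f₂ {0F} {2F} _ = ℕ.<-trans f₀<f₁ f₁<f₂
fin3-monotone f f₀<f₁ f₁<f₂ {1F} {2F} _ = f₁<f₂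
fin3-monotone f f₀<f₁ f₁<f₂ {1F} {1F} (s≤s ())
fin3-monotone f f₀<f₁ f₁<f₂ {2F} {1F} (s≤s ())
fin3-monotone f f₀<f₁ f₁<f₂ {2F} {2F} (s≤s (s≤s ()))

unimodal⇒avoids : (π : Permutation′ n) → Unimodal π → (ρ : Permutation′ 3) →
                  ρ ⟨$⟩ʳ 1F < ρ ⟨$⟩ʳ 0F → ρ ⟨$⟩ʳ 1F < ρ ⟨$⟩ʳ 2F → Avoids π ρ
unimodal⇒avoids π u ρ ρ₁<ρ₀ ρ₁<ρ₂ (ι , mono , iso) =
  u (mono {0F} {1F} (s≤s z≤n)) (mono {1F} {2F} (s≤s (s≤s z≤n)))
    (Equivalence.from (iso 1F 0F) ρ₁<ρ₀) (Equivalence.from (iso 1F 2F) ρ₁<ρ₂)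

-- Since `ρ` is injective and the order total, preservation already forces reflection. The entries
-- are listed by increasing pattern value through `ρ ⟨$⟩ˡ_`, so for a pattern of length three the
-- last hypothesis is again an instance of `fin3-monotone`.
order-preserving⇒contains : (π : Permutation′ n) (ρ : Permutation′ m) (ι : Fin m → Fin n) →
  (∀ {a b} → a < b → ι a < ι b) →
  (∀ {x y} → x < y → π ⟨$⟩ʳ ι (ρ ⟨$⟩ˡ x) < π ⟨$⟩ʳ ι (ρ ⟨$⟩ˡ y)) →
  Contains π ρ
order-preserving⇒contains π ρ ι mono pres = ι , mono , λ a b → mk⇔ (reflects a b) (preserves a b)
  where
  preserves : ∀ a b → ρ ⟨$⟩ʳ a < ρ ⟨$⟩ʳ b → π ⟨$⟩ʳ ι a < π ⟨$⟩ʳ ι b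
  preserves a b ρa<ρb = subst₂ (λ c d → π ⟨$⟩ʳ ι c < π ⟨$⟩ʳ ι d)
    (inverseˡ ρ) (inverseˡ ρ) (pres ρa<ρb)

  reflects : ∀ a b → π ⟨$⟩ʳ ι a < π ⟨$⟩ʳ ι b → ρ ⟨$⟩ʳ a < ρ ⟨$⟩ʳ b
  reflects a b lt with <-cmp (ρ ⟨$⟩ʳ a) (ρ ⟨$⟩ʳ b)
  ... | tri< ρa<ρb _ _ = ρa<ρb
  ... | tri> _ _ ρb<ρa = contradiction (preserves b a ρb<ρa) (ℕ.<-asym lt)
  ... | tri≈ _ ρa≡ρb _ with refl ← ⟨$⟩ʳ-injective ρ ρa≡ρb = contradiction lt (ℕ.<-irrefl refl)

-- The outer entries of a valley are distinct, and their order decides which of the two patterns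
-- occurs.
avoids⇒unimodal : (π : Permutation′ n) → Avoids π p213 → Avoids π p312 → Unimodal π
avoids⇒unimodal {n} π av213 av312 {i} {j} {k} i<j j<k πj<πi πj<πk
  with <-cmp (π ⟨$⟩ʳ i) (π ⟨$⟩ʳ k)
... | tri≈ _ πi≡πk _ =
  contradiction (cong toℕ (⟨$⟩ʳ-injective π πi≡πk)) (ℕ.<⇒≢ (ℕ.<-trans i<j j<k))
... | tri< πi<πk _ _ = av213 (order-preserving⇒contains π p213 ι
  (fin3-monotone ι i<j j<k) (fin3-monotone (λ x → π ⟨$⟩ʳ ι (p213 ⟨$⟩ˡ x)) πj<πi πi<πk))
  where ι = lookup (i ∷ j ∷ k ∷ [])
... | tri> _ _ πk<πi = av312 (order-preserving⇒contains π p312 ι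
  (fin3-monotone ι i<j j<k) (fin3-monotone (λ x → π ⟨$⟩ʳ ι (p312 ⟨$⟩ˡ x)) πj<πk πk<πi))
  where ι = lookup (i ∷ j ∷ k ∷ [])

-- Unimodality under deletion and insertion

remove-unimodal : ∀ i {π : Permutation′ (suc n)} → Unimodal π → Unimodal (remove i π)
remove-unimodal i {π} u a<b b<c πb<πa πb<πc =
  u (punchIn-mono-< i a<b) (punchIn-mono-< i b<c) (lift πb<πa) (lift πb<πc)
  where
  lift : ∀ {b c} → remove i π ⟨$⟩ʳ b < remove i π ⟨$⟩ʳ c →
         π ⟨$⟩ʳ punchIn i b < π ⟨$⟩ʳ punchIn i c
  lift {b} {c} lt = subst₂ _<_ (sym (punchIn-permute π i b)) (sym (punchIn-permute π i c))
    (punchIn-mono-< (π ⟨$⟩ʳ i) lt)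

end : ∀ n → Bool → Fin (suc n)
end n true  = zero
end n false = fromℕ n

end-not-inner : ∀ e {i j k : Fin (suc n)} → i < j → j < k → end n e ≢ j
end-not-inner true  () _   refl
end-not-inner false {k = k} _ j<k refl = ℕ.<⇒≱ j<k (≤fromℕ k)

-- The new minimum cannot be an outer entry of a valley, being smallest, nor its bottom, standing at
-- an end. Any valley therefore lies in `π` already.
insert-unimodal : ∀ e {π : Permutation′ n} → Unimodal π → Unimodal (insert (end n e) zero π)
insert-unimodal {n} e {π} u {i} {j} {k} i<j j<k lt₁ lt₂ =
  go (position i) (position j) (position k)
  where
  p : Fin (suc n)
  p = end n e

  σ : Permutation′ (suc n)
  σ = insert p zero π

  position : ∀ x → p ≡ x ⊎ ∃ λ y → punchIn p y ≡ x
  position x with p ≟ x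
  ... | yes p≡x = inj₁ p≡x
  ... | no  p≢x = inj₂ (punchOut p≢x , punchIn-punchOut p≢x)

  minimum : ∀ x → ¬ σ ⟨$⟩ʳ x < σ ⟨$⟩ʳ p
  minimum x lt with () ← subst (σ ⟨$⟩ʳ x <_) (insert-at p zero π) lt

  lower : ∀ {x y} → σ ⟨$⟩ʳ punchIn p x < σ ⟨$⟩ʳ punchIn p y → π ⟨$⟩ʳ x < π ⟨$⟩ʳ y
  lower lt = ℕ.s<s⁻¹ (subst₂ _<_ (insert-punchIn p zero π _) (insert-punchIn p zero π _) lt)

  go : p ≡ i ⊎ (∃ λ y → punchIn p y ≡ i) → p ≡ j ⊎ (∃ λ y → punchIn p y ≡ j) →
       p ≡ k ⊎ (∃ λ y → punchIn p y ≡ k) → ⊥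
  go (inj₁ refl) _ _ = minimum j lt₁
  go _ (inj₁ p≡j) _ = end-not-inner e i<j j<k p≡j
  go _ _ (inj₁ refl) = minimum j lt₂
  go (inj₂ (_ , refl)) (inj₂ (_ , refl)) (inj₂ (_ , refl)) =
    u (punchIn-cancel-< p i<j) (punchIn-cancel-< p j<k) (lower lt₁) (lower lt₂)

-- At an inner position the value `zero` would form a valley with the first and the last letter.
minimum-at-end : (π : Permutation′ (suc n)) → Unimodal π → ∃ λ e → π ⟨$⟩ʳ end n e ≡ zero
minimum-at-end {n} π u with π ⟨$⟩ˡ zero | inverseʳ π {zero}
... | p | πp≡0 with p ≟ zero | p ≟ fromℕ n
... | yes refl | _        = true , πp≡0
... | _        | yes refl = false , πp≡0
... | no p≢0   | no p≢n   = contradiction (above p≢n) (u (≢0⇒0< p≢0) (≢fromℕ⇒<fromℕ p≢n) (above p≢0))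
  where
  above : ∀ {q} → p ≢ q → π ⟨$⟩ʳ p < π ⟨$⟩ʳ q
  above p≢q rewrite πp≡0 = ≢0⇒0< λ πq≡0 → p≢q (⟨$⟩ʳ-injective π (trans πp≡0 (sym πq≡0)))

-- The coding of unimodal permutations by subsets

-- The head places the smallest value and raises all others by one, so the word grows outwards from
-- its maximum. The empty code gives one letter, for which both ends coincide; hence an `n`-set
-- encodes length `suc n`.
word : Subset n → Permutation′ (suc n)
word []          = Perm.id
word {n} (e ∷ c) = insert (end n e) zero (word c)

word-unimodal : (c : Subset n) → Unimodal (word c)
word-unimodal []      {0F} {0F} ()
word-unimodal (e ∷ c) = insert-unimodal e {word c} (word-unimodal c)

-- The position of `zero` reveals the head of the code, and the remaining letters reveal its tail.
word-injective : (c d : Subset n) → (∀ i → word c ⟨$⟩ʳ i ≡ word d ⟨$⟩ʳ i) → c ≡ d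
word-injective []          []      _   = refl
word-injective {suc n} (e ∷ c) (f ∷ d) c≗d = go (end-injective e f same-end)
  where
  -- The words here have at least two letters, so the two ends are different positions.
  end-injective : ∀ e f → end (suc n) e ≡ end (suc n) f → e ≡ f
  end-injective true  true  _ = refl
  end-injective false false _ = refl

  same-end : end (suc n) e ≡ end (suc n) f
  same-end = ⟨$⟩ʳ-injective (word (f ∷ d)) (begin
    word (f ∷ d) ⟨$⟩ʳ end (suc n) e ≡⟨ c≗d _ ⟨
    word (e ∷ c) ⟨$⟩ʳ end (suc n) e ≡⟨ insert-at (end (suc n) e) zero (word c) ⟩
    zero                            ≡⟨ insert-at (end (suc n) f) zero (word d) ⟨
    word (f ∷ d) ⟨$⟩ʳ end (suc n) f ∎)
    where open ≡-Reasoning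

  go : e ≡ f → e ∷ c ≡ f ∷ d
  go refl = cong (e ∷_) (word-injective c d λ i → Fin.suc-injective (begin
    suc (word c ⟨$⟩ʳ i)                           ≡⟨ insert-punchIn (end (suc n) e) zero (word c) i ⟨
    word (e ∷ c) ⟨$⟩ʳ punchIn (end (suc n) e) i   ≡⟨ c≗d _ ⟩
    word (e ∷ d) ⟨$⟩ʳ punchIn (end (suc n) e) i   ≡⟨ insert-punchIn (end (suc n) e) zero (word d) i ⟩
    suc (word d ⟨$⟩ʳ i)                           ∎))
    where open ≡-Reasoning

word-surjective : (π : Permutation′ (suc n)) → Unimodal π →
                  ∃ λ c → ∀ i → word c ⟨$⟩ʳ i ≡ π ⟨$⟩ʳ i
word-surjective {zero}  π u = [] , λ { 0F → fin1 (π ⟨$⟩ʳ 0F) }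
  where
  fin1 : (i : Fin 1) → 0F ≡ i
  fin1 0F = refl
word-surjective {suc n} π u
  with e , πp≡0 ← minimum-at-end π u
  with c , c≗ ← word-surjective (remove (end (suc n) e) π) (remove-unimodal (end (suc n) e) {π} u)
  = e ∷ c , λ i → begin
    insert p zero (word c) ⟨$⟩ʳ i              ≡⟨ insert-cong p zero {word c} {remove p π} c≗ i ⟩
    -- The removed value was `zero`, so inserting `zero` undoes the removal.
    insert p zero (remove p π) ⟨$⟩ʳ i          ≡⟨ cong (λ j → insert p j (remove p π) ⟨$⟩ʳ i) πp≡0 ⟨
    insert p (π ⟨$⟩ʳ p) (remove p π) ⟨$⟩ʳ i    ≡⟨ insert-remove p π i ⟩
    π ⟨$⟩ʳ i                                   ∎
  where
  open ≡-Reasoning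
  p = end (suc n) e

-- Double ascents and double descents

⟦_⟧ : Bool → ℕ
⟦ b ⟧ = if b then 1 else 0

count : (Fin n → Bool) → ℕ
count {zero}  f = 0
count {suc n} f = ⟦ f zero ⟧ + count (f ∘ suc)

count-cong : {f g : Fin n → Bool} → (∀ i → f i ≡ g i) → count f ≡ count g
count-cong {zero}  f≗g = refl
count-cong {suc n} f≗g = cong₂ (λ b m → ⟦ b ⟧ + m) (f≗g zero) (count-cong (f≗g ∘ suc))

-- Needed for minima placed at the end of a word, which affect only the last window of three
-- letters.
count-last : (f : Fin (suc n) → Bool) → count f ≡ ⟦ f (fromℕ n) ⟧ + count (f ∘ inject₁)
count-last {zero}  f = refl
count-last {suc n} f = begin
  ⟦ f 0F ⟧ + count (f ∘ suc)                                        ≡⟨ cong (⟦ f 0F ⟧ +_) (count-last (f ∘ suc)) ⟩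
  ⟦ f 0F ⟧ + (⟦ f (fromℕ (suc n)) ⟧ + count (f ∘ suc ∘ inject₁))    ≡⟨ x∙yz≈y∙xz ℕ.+-commutativeSemigroup ⟦ f 0F ⟧ ⟦ f (fromℕ (suc n)) ⟧ _ ⟩
  ⟦ f (fromℕ (suc n)) ⟧ + (⟦ f 0F ⟧ + count (f ∘ suc ∘ inject₁))    ∎
  where open ≡-Reasoning

length-filter-tabulate : ∀ {A : Set} {P : Pred A 0ℓ} (P? : Decidable P) (f : Fin n → A) →
                         length (filter P? (tabulate f)) ≡ count (does ∘ P? ∘ f)
length-filter-tabulate {zero}  P? f = refl
length-filter-tabulate {suc n} P? f with does (P? (f zero))
... | true  = cong suc (length-filter-tabulate P? (f ∘ suc))
... | false = length-filter-tabulate P? (f ∘ suc)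

below : (Fin m → Fin n) → Fin m → Fin m → Bool
below w i j = does (w i <? w j)

doubleRise doubleFall : (Fin (suc (suc m)) → Fin n) → Fin m → Bool
doubleRise w i = below w (1st i) (2nd i) ∧ below w (2nd i) (3rd i)
doubleFall w i = below w (2nd i) (1st i) ∧ below w (3rd i) (2nd i)

-- `does` of a product decision computes to a conjunction, so the decision procedure agrees with
-- `doubleRise` by computation.
dasc-count : (π : Permutation′ (suc (suc m))) → dasc π ≡ count (doubleRise (π ⟨$⟩ʳ_))
dasc-count π = length-filter-tabulate (doubleAscent? π) id

ddes-count : (π : Permutation′ (suc (suc m))) → ddes π ≡ count (doubleFall (π ⟨$⟩ʳ_))
ddes-count π = length-filter-tabulate (doubleDescent? π) id

below-cong : (v : Fin m → Fin n) (w : Fin a → Fin n) (f : Fin a → Fin m) →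
             (∀ i → v (f i) ≡ w i) → ∀ i j → below v (f i) (f j) ≡ below w i j
below-cong v w f vf≗w i j = cong₂ (λ x y → does (x <? y)) (vf≗w i) (vf≗w j)

dasc-cong : (π ρ : Permutation′ n) → (∀ i → π ⟨$⟩ʳ i ≡ ρ ⟨$⟩ʳ i) → dasc π ≡ dasc ρ
dasc-cong {zero}        π ρ π≗ρ = refl
dasc-cong {suc zero}    π ρ π≗ρ = refl
dasc-cong {suc (suc m)} π ρ π≗ρ = begin
  dasc π                        ≡⟨ dasc-count π ⟩
  count (doubleRise (π ⟨$⟩ʳ_))  ≡⟨ count-cong (λ i → cong₂ _∧_ (cong-< (1st i) (2nd i)) (cong-< (2nd i) (3rd i))) ⟩
  count (doubleRise (ρ ⟨$⟩ʳ_))  ≡⟨ dasc-count ρ ⟨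
  dasc ρ                        ∎
  where
  open ≡-Reasoning
  cong-< = below-cong (π ⟨$⟩ʳ_) (ρ ⟨$⟩ʳ_) id π≗ρ

ddes-cong : (π ρ : Permutation′ n) → (∀ i → π ⟨$⟩ʳ i ≡ ρ ⟨$⟩ʳ i) → ddes π ≡ ddes ρ
ddes-cong {zero}        π ρ π≗ρ = refl
ddes-cong {suc zero}    π ρ π≗ρ = refl
ddes-cong {suc (suc m)} π ρ π≗ρ = begin
  ddes π                        ≡⟨ ddes-count π ⟩
  count (doubleFall (π ⟨$⟩ʳ_))  ≡⟨ count-cong (λ i → cong₂ _∧_ (cong-< (2nd i) (1st i)) (cong-< (3rd i) (2nd i))) ⟩
  count (doubleFall (ρ ⟨$⟩ʳ_))  ≡⟨ ddes-count ρ ⟨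
  ddes ρ                        ∎
  where
  open ≡-Reasoning
  cong-< = below-cong (π ⟨$⟩ʳ_) (ρ ⟨$⟩ʳ_) id π≗ρ

word-false-inject₁ : (c : Subset n) (i : Fin (suc n)) →
                     word (false ∷ c) ⟨$⟩ʳ inject₁ i ≡ suc (word c ⟨$⟩ʳ i)
word-false-inject₁ {n} c i = begin
  word (false ∷ c) ⟨$⟩ʳ inject₁ i                    ≡⟨ cong (word (false ∷ c) ⟨$⟩ʳ_) (punchIn-fromℕ i) ⟨
  word (false ∷ c) ⟨$⟩ʳ punchIn (fromℕ (suc n)) i    ≡⟨ insert-punchIn (fromℕ (suc n)) zero (word c) i ⟩
  suc (word c ⟨$⟩ʳ i)                                ∎
  where open ≡-Reasoning

word-false-last : (c : Subset n) → word (false ∷ c) ⟨$⟩ʳ fromℕ (suc n) ≡ zero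
word-false-last {n} c = insert-at (fromℕ (suc n)) zero (word c)

-- The old letters keep their positions and grow by one; `does (suc x <? suc y)` computes to
-- `does (x <? y)`.
below-word-false : (c : Subset n) (i j : Fin (suc n)) →
  below (word (false ∷ c) ⟨$⟩ʳ_) (inject₁ i) (inject₁ j) ≡ below (word c ⟨$⟩ʳ_) i j
below-word-false c =
  below-cong (word (false ∷ c) ⟨$⟩ʳ_) (suc ∘ (word c ⟨$⟩ʳ_)) inject₁ (word-false-inject₁ c)

firstRise lastFall : Subset (suc n) → Bool
firstRise c = below (word c ⟨$⟩ʳ_) 0F 1F
lastFall {n} c = below (word c ⟨$⟩ʳ_) (fromℕ (suc n)) (inject₁ (fromℕ n))

-- A unimodal word begins with an ascent unless it has no ascent at all.
firstRise+pred : (c : Subset (suc n)) → ⟦ firstRise c ⟧ + pred ∣ c ∣ ≡ ∣ c ∣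
firstRise+pred (true ∷ c)          = refl
firstRise+pred (false ∷ [])        = refl
firstRise+pred (false ∷ c@(_ ∷ _)) = begin
  ⟦ firstRise (false ∷ c) ⟧ + pred ∣ c ∣  ≡⟨ cong (λ b → ⟦ b ⟧ + pred ∣ c ∣) (below-word-false c 0F 1F) ⟩
  ⟦ firstRise c ⟧ + pred ∣ c ∣            ≡⟨ firstRise+pred c ⟩
  ∣ c ∣                                   ∎
  where open ≡-Reasoning

lastFall-false : (c : Subset n) → lastFall (false ∷ c) ≡ true
lastFall-false c = cong₂ (λ x y → does (x <? y)) (word-false-last c) (word-false-inject₁ c (fromℕ _))

-- Under the complement, `c` records the minima placed at the end: the word ends with a descent
-- unless `c` is empty, and letters added in front do not disturb that descent.
lastFall+pred : (c : Subset (suc n)) → ⟦ lastFall (∁ c) ⟧ + pred ∣ c ∣ ≡ ∣ c ∣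
lastFall+pred (true ∷ c)           = cong (λ b → ⟦ b ⟧ + ∣ c ∣) (lastFall-false (∁ c))
lastFall+pred (false ∷ [])         = refl
lastFall+pred (false ∷ c@(_ ∷ _))  = lastFall+pred c

-- A minimum in front creates one double ascent exactly when the rest begins with an ascent; a
-- minimum at the end creates none. The truncation `pred 0 = 0` covers words without ascents.
dasc-word : (c : Subset n) → dasc (word c) ≡ pred ∣ c ∣
dasc-word []          = refl
dasc-word (true ∷ []) = refl
dasc-word (false ∷ []) = refl
dasc-word (true ∷ c@(_ ∷ _)) = begin
  dasc (word (true ∷ c))                                   ≡⟨ dasc-count (word (true ∷ c)) ⟩
  -- By computation: the leading `zero` is always followed by a rise, so the first window is decided
  -- by `firstRise c`, and the other windows are those of `word c`.
  ⟦ firstRise c ⟧ + count (doubleRise (word c ⟨$⟩ʳ_))      ≡⟨ cong (⟦ firstRise c ⟧ +_) (dasc-count (word c)) ⟨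
  ⟦ firstRise c ⟧ + dasc (word c)                          ≡⟨ cong (⟦ firstRise c ⟧ +_) (dasc-word c) ⟩
  ⟦ firstRise c ⟧ + pred ∣ c ∣                             ≡⟨ firstRise+pred c ⟩
  ∣ c ∣                                                    ∎
  where open ≡-Reasoning
dasc-word {suc (suc m)} (false ∷ c@(_ ∷ _)) = begin
  dasc (word (false ∷ c))                                              ≡⟨ dasc-count (word (false ∷ c)) ⟩
  count (doubleRise w)                                                 ≡⟨ count-last (doubleRise w) ⟩
  ⟦ doubleRise w (fromℕ m) ⟧ + count (doubleRise w ∘ inject₁)          ≡⟨ cong₂ (λ b l → ⟦ b ⟧ + l) last-not-rise (count-cong rest) ⟩
  count (doubleRise (word c ⟨$⟩ʳ_))                                    ≡⟨ dasc-count (word c) ⟨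
  dasc (word c)                                                        ≡⟨ dasc-word c ⟩
  pred ∣ c ∣                                                           ∎
  where
  open ≡-Reasoning
  w : Fin (3 + m) → Fin (3 + m)
  w = word (false ∷ c) ⟨$⟩ʳ_

  -- The last window ends in `zero`, and nothing lies below `zero`.
  last-not-rise : doubleRise w (fromℕ m) ≡ false
  last-not-rise = trans
    (cong (λ x → below w (1st (fromℕ m)) (2nd (fromℕ m)) ∧ does (w (2nd (fromℕ m)) <? x)) (word-false-last c))
    (∧-zeroʳ _)

  -- `1st`, `2nd` and `3rd` commute with `inject₁` by computation.
  rest : ∀ i → doubleRise w (inject₁ i) ≡ doubleRise (word c ⟨$⟩ʳ_) i
  rest i = cong₂ _∧_ (below-word-false c (1st i) (2nd i)) (below-word-false c (2nd i) (3rd i))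

-- Complementing the code exchanges the two ends, so the argument for double ascents recurs in
-- mirror image and yields the same value.
ddes-word-∁ : (c : Subset n) → ddes (word (∁ c)) ≡ pred ∣ c ∣
ddes-word-∁ []           = refl
ddes-word-∁ (true ∷ [])  = refl
ddes-word-∁ (false ∷ []) = refl
ddes-word-∁ (false ∷ c@(_ ∷ _)) = begin
  ddes (word (true ∷ ∁ c))              ≡⟨ ddes-count (word (true ∷ ∁ c)) ⟩
  -- No letter falls below the leading `zero`... so the first window contributes nothing, by
  -- computation.
  count (doubleFall (word (∁ c) ⟨$⟩ʳ_)) ≡⟨ ddes-count (word (∁ c)) ⟨
  ddes (word (∁ c))                     ≡⟨ ddes-word-∁ c ⟩
  pred ∣ c ∣                            ∎
  where open ≡-Reasoning
ddes-word-∁ {suc (suc m)} (true ∷ c@(_ ∷ _)) = begin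
  ddes (word (false ∷ ∁ c))                                            ≡⟨ ddes-count (word (false ∷ ∁ c)) ⟩
  count (doubleFall w)                                                 ≡⟨ count-last (doubleFall w) ⟩
  ⟦ doubleFall w (fromℕ m) ⟧ + count (doubleFall w ∘ inject₁)          ≡⟨ cong₂ (λ b l → ⟦ b ⟧ + l) last-fall (count-cong rest) ⟩
  ⟦ lastFall (∁ c) ⟧ + count (doubleFall (word (∁ c) ⟨$⟩ʳ_))           ≡⟨ cong (⟦ lastFall (∁ c) ⟧ +_) (ddes-count (word (∁ c))) ⟨
  ⟦ lastFall (∁ c) ⟧ + ddes (word (∁ c))                               ≡⟨ cong (⟦ lastFall (∁ c) ⟧ +_) (ddes-word-∁ c) ⟩
  ⟦ lastFall (∁ c) ⟧ + pred ∣ c ∣                                      ≡⟨ lastFall+pred c ⟩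
  ∣ c ∣                                                                ∎
  where
  open ≡-Reasoning
  w : Fin (3 + m) → Fin (3 + m)
  w = word (false ∷ ∁ c) ⟨$⟩ʳ_

  -- The step down to the final `zero` is automatic, so only the preceding pair matters.
  last-fall : doubleFall w (fromℕ m) ≡ lastFall (∁ c)
  last-fall = trans
    (cong₂ _∧_ (below-word-false (∁ c) (fromℕ (suc m)) (inject₁ (fromℕ m))) (lastFall-false (∁ c)))
    (∧-identityʳ _)

  rest : ∀ i → doubleFall w (inject₁ i) ≡ doubleFall (word (∁ c) ⟨$⟩ʳ_) i
  rest i = cong₂ _∧_ (below-word-false (∁ c) (2nd i) (1st i)) (below-word-false (∁ c) (3rd i) (2nd i))

-- Counting subsets

Sized : ℕ → ℕ → Set
Sized n a = Σ[ c ∈ Subset n ] ∣ c ∣ ≡ a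

Sized-zero : ∀ n → Sized n 0 ↔ ⊤
Sized-zero n = mk↔ₛ′ _ (λ _ → ⊥ₛ , ∣⊥∣≡0 n) (λ _ → refl) λ (c , ∣c∣≡0) → unique n c ∣c∣≡0
  where
  unique : ∀ n (c : Subset n) (e : ∣ c ∣ ≡ 0) → (⊥ₛ , ∣⊥∣≡0 n) ≡ (c , e)
  unique zero    []          refl = refl
  unique (suc n) (false ∷ c) e    =
    cong (λ (d , e) → (false ∷ d) , e) (unique n c e)

-- Pascal's rule as a bijection: the head is chosen or not.
Sized-suc : ∀ n a → Sized (suc n) (suc a) ↔ (Sized n a ⊎ Sized n (suc a))
Sized-suc n a = mk↔ₛ′ to from
  (λ { (inj₁ (c , refl)) → refl ; (inj₂ _) → refl })
  (λ { (true ∷ c , refl) → refl ; (false ∷ c , _) → refl })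
  where
  to : Sized (suc n) (suc a) → Sized n a ⊎ Sized n (suc a)
  to (true  ∷ c , e) = inj₁ (c , ℕ.suc-injective e)
  to (false ∷ c , e) = inj₂ (c , e)

  from : Sized n a ⊎ Sized n (suc a) → Sized (suc n) (suc a)
  from (inj₁ (c , e)) = true ∷ c , cong suc e
  from (inj₂ (c , e)) = false ∷ c , e

Sized↔Fin : ∀ n a → Sized n a ↔ Fin (n C a)
Sized↔Fin n       zero    = ↔-trans (Sized-zero n) (↔-sym 1↔⊤)
Sized↔Fin zero    (suc a) = mk↔ₛ′ (λ { ([] , ()) }) (λ ()) (λ ()) (λ { ([] , ()) })
Sized↔Fin (suc n) (suc a) =
  ↔-trans (Sized-suc n a)
  (↔-trans (Sized↔Fin n a ⊎-↔ Sized↔Fin n (suc a))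
  (↔-trans (↔-sym +↔⊎)
  (cast-id (nCk+nC[k+1]≡[n+1]C[k+1] n a))))

-- The codes on which the statistic takes the value `k`. Truncation merges the sizes 0 and 1 when
-- `k` is 0, which is the source of the exceptional case in `formula`.
PredSized : ℕ → ℕ → Set
PredSized n k = Σ[ c ∈ Subset n ] pred ∣ c ∣ ≡ k

PredSized-≡ : {x y : PredSized n k} → proj₁ x ≡ proj₁ y → x ≡ y
PredSized-≡ {x = c , _} refl = cong (c ,_) (ℕ.≡-irrelevant _ _)

PredSized-zero : ∀ n → (Sized n 0 ⊎ Sized n 1) ↔ PredSized n 0
PredSized-zero n = ⤖⇒↔ (mk⤖ (injective _ _ , strictlySurjective⇒surjective surjective))
  where
  to : Sized n 0 ⊎ Sized n 1 → PredSized n 0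
  to (inj₁ (c , e)) = c , cong pred e
  to (inj₂ (c , e)) = c , cong pred e

  injective : ∀ x y → to x ≡ to y → x ≡ y
  injective (inj₁ (c , e)) (inj₁ (d , f)) eq with refl ← cong proj₁ eq =
    cong (inj₁ ∘ (c ,_)) (ℕ.≡-irrelevant e f)
  injective (inj₂ (c , e)) (inj₂ (d , f)) eq with refl ← cong proj₁ eq =
    cong (inj₂ ∘ (c ,_)) (ℕ.≡-irrelevant e f)
  injective (inj₁ (c , e)) (inj₂ (d , f)) eq with refl ← cong proj₁ eq with () ← trans (sym e) f
  injective (inj₂ (c , e)) (inj₁ (d , f)) eq with refl ← cong proj₁ eq with () ← trans (sym e) f

  surjective : ∀ y → ∃ λ x → to x ≡ y
  surjective (c , e) = go ∣ c ∣ refl e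
    where
    -- The size is abstracted to `s` so that it can be matched; sizes above 1 contradict
    -- `pred s ≡ 0`.
    go : ∀ s → ∣ c ∣ ≡ s → pred s ≡ 0 → ∃ λ x → to x ≡ (c , e)
    go 0 f _ = inj₁ (c , f) , PredSized-≡ refl
    go 1 f _ = inj₂ (c , f) , PredSized-≡ refl

PredSized-suc : ∀ n k → Sized n (2 + k) ↔ PredSized n (suc k)
PredSized-suc n k = mk↔ₛ′
  (λ (c , e) → c , cong pred e)
  (λ (c , e) → c , pred-injective ∣ c ∣ e)
  (λ _ → PredSized-≡ refl)
  (λ (c , e) → cong (c ,_) (ℕ.≡-irrelevant _ _))
  where
  pred-injective : ∀ s → pred s ≡ suc k → s ≡ 2 + k
  pred-injective (suc s) refl = refl

PredSized↔Fin : ∀ n k → PredSized n k ↔ Fin (formula (suc n) k)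
PredSized↔Fin n zero    =
  ↔-trans (↔-sym (PredSized-zero n))
  -- Pascal's rule backwards: the empty set and the singletons of an `n`-set match the singletons of
  -- a set with `suc n` elements.
  (↔-trans (↔-sym (Sized-suc n 0))
  (↔-trans (Sized↔Fin (suc n) 1)
  (cast-id (nC1≡n (suc n)))))
PredSized↔Fin n (suc k) =
  ↔-trans (↔-sym (PredSized-suc n k))
  (↔-trans (Sized↔Fin n (2 + k))
  (cast-id (cong (n C_) (ℕ.+-comm 1 (suc k)))))

-- Double ascents are read off the chosen elements (f = id), double descents off
-- the others (f = ∁).
avoiders-count : (stat : ∀ {n} → Permutation′ n → ℕ) →
  (∀ {n} (π ρ : Permutation′ n) → (∀ i → π ⟨$⟩ʳ i ≡ ρ ⟨$⟩ʳ i) → stat π ≡ stat ρ) →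
  (f : Subset n ↔ Subset n) →
  (∀ c → stat (word (Inverse.to f c)) ≡ pred ∣ c ∣) →
  ∀ k → ∣ Av⟨213,312⟩ stat (suc n) k ∣≡ formula (suc n) k
avoiders-count {n} stat stat-cong f stat-word k =
  Comp.inverse (Sym.inverse (Bijection⇒Inverse coding)) (PredSized↔Fin n k)
  where
  open Inverse f using (to; from; strictlyInverseˡ)

  S : Setoid 0ℓ 0ℓ
  S = Av⟨213,312⟩ stat (suc n) k

  decode : PredSized n k → Setoid.Carrier S
  decode (c , e) = word (to c) ,
    unimodal⇒avoids (word (to c)) u p213 (s≤s z≤n) (s≤s z≤n) ,
    unimodal⇒avoids (word (to c)) u p312 (s≤s z≤n) (s≤s z≤n) ,
    trans (stat-word c) e
    where
    u : Unimodal (word (to c))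
    u {i} {j} {k} = word-unimodal (to c) {i} {j} {k}

  decode-surjective : ∀ y → ∃ λ x → Setoid._≈_ S (decode x) y
  decode-surjective (π , av213 , av312 , e)
    with c , c≗π ← word-surjective π (avoids⇒unimodal π av213 av312) =
    -- The code of `π` is pulled back along `f`; the statistic transfers because it depends only on
    -- the letters of the word.
    (from c , trans (sym (stat-word (from c))) (trans (stat-cong _ π fc≗π) e)) , fc≗π
    where
    fc≗π : ∀ i → word (to (from c)) ⟨$⟩ʳ i ≡ π ⟨$⟩ʳ i
    fc≗π i = trans (cong (λ d → word d ⟨$⟩ʳ i) (strictlyInverseˡ c)) (c≗π i)

  decode-cong : {x y : PredSized n k} → x ≡ y → Setoid._≈_ S (decode x) (decode y)
  decode-cong refl i = refl

  coding : Bijection (setoid (PredSized n k)) S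
  coding = record
    { to        = decode
    ; cong      = λ {x} {y} → decode-cong {x} {y}
    ; bijective =
        (λ {x} {y} eq → PredSized-≡ (Injection.injective (↔⇒↣ f) (word-injective _ _ eq))) ,
        (λ y → proj₁ (decode-surjective y) , λ { refl → proj₂ (decode-surjective y) })
    }

∁-involutive : (c : Subset n) → ∁ (∁ c) ≡ c
∁-involutive c = trans (sym (map-∘ not not c)) (trans (map-cong not-involutive c) (map-id c))

proposition7 : ∀ (n k : ℕ) → n ≥ 1 →
    (∣ Av⟨213,312⟩ dasc n k ∣≡ formula n k) × (∣ Av⟨213,312⟩ ddes n k ∣≡ formula n k)
proposition7 (suc n) k _ =
  avoiders-count dasc dasc-cong (↔-id _) dasc-word k ,
  avoiders-count ddes ddes-cong (mk↔ₛ′ ∁ ∁ ∁-involutive ∁-involutive) ddes-word-∁ k
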